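{- For every integer $k\geqslant 0$ there exists $n_0$ such that for every integer $n\geqslant n_0$ and every integer $m\in\{0,1,\dots,k\}$, $m$ is an eigenvalue of the adjacency matrix of the Transposition graph $T_n$.
   Context: The Transposition graph $T_n$ is the Cayley graph $\mathrm{Cay}(\mathrm{Sym}_n,T)$ on the symmetric group $\mathrm{Sym}_n$, where $T$ is the set of all $\binom{n}{2}$ transpositions; two permutations $\pi,\sigma$ are adjacent iff $\sigma=\pi\tau$ for some $\tau\in T$. Its spectrum $Spec(T_n)$ is the set of eigenvalues of its adjacency matrix. -}

module Defs where

open import Data.Nat using (ℕ; _<_; _<?_)
open import Data.Fin using (Fin; toℕ)
open import Data.Fin.Permutation.Components using (transpose)
open import Data.Vec using (Vec; lookup; tabulate)
open import Data.List using (List; concatMap; filter; map; foldr; allFin)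
open import Data.Product using (_×_; _,_; ∃; Σ)
open import Data.Integer using (+_)
open import Data.Rational using (ℚ; _+_; _*_; 0ℚ; _/_)
open import Relation.Binary.PropositionalEquality using (_≡_; _≢_)
open import Relation.Nullary.Decidable using (Dec)

IsPerm : ∀ {n} → Vec (Fin n) n → Set
IsPerm {n} π = ∀ (a b : Fin n) → lookup π a ≡ lookup π b → a ≡ b

transpositions : (n : ℕ) → List (Fin n × Fin n)
transpositions n =
  filter (λ p → toℕ (Data.Product.proj₁ p) <? toℕ (Data.Product.proj₂ p))
    (concatMap (λ i → map (λ j → (i , j)) (allFin n)) (allFin n))

_∘ᵗ_ : ∀ {n} → Vec (Fin n) n → Fin n × Fin n → Vec (Fin n) n
π ∘ᵗ (i , j) = tabulate (λ k → lookup π (transpose i j k))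

sumℚ : List ℚ → ℚ
sumℚ = foldr _+_ 0ℚ

-- Adjacency matrix A of T_n = Cay(Sym_n, T) applied to a vector v : Sym_n → ℚ:
-- (A v)(π) = Σ_{σ adjacent to π} v(σ) = Σ_{τ ∈ T} v(π τ).
adj : ∀ {n} → (Vec (Fin n) n → ℚ) → Vec (Fin n) n → ℚ
adj {n} v π = sumℚ (map (λ τ → v (π ∘ᵗ τ)) (transpositions n))

-- λ is an eigenvalue of the adjacency matrix of T_n: there is a nonzero vector v
-- on the vertex set Sym_n with A v = λ v.  (v is a function on all of Vec (Fin n) n,
-- but only its values on permutations matter: nonzero at some permutation and
-- the eigen-equation holds at every permutation.)
IsEigenvalueT : (n : ℕ) → ℚ → Set
IsEigenvalueT n λ' =
  Σ (Vec (Fin n) n → ℚ) λ v →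
    (∃ λ π → IsPerm π × v π ≢ 0ℚ) ×
    (∀ π → IsPerm π → adj v π ≡ λ' * v π)

{-# OPTIONS --safe #-}

-- For a partition of n with column lengths cs, the Specht polynomial (the product
-- of the Vandermonde products of the columns) evaluated at the entries of a
-- permutation is an eigenvector of the adjacency operator.  A transposition inside
-- a column negates it.  For an entry outside a given column, in a column that is
-- not longer, the swaps with all entries of the given column add up to the
-- polynomial itself, by Lagrange interpolation.  Hence the eigenvalue is the sum of the contents of the partition.
--
-- The hook with arm m and leg m − 1 has content sum m.  Wrapping self-conjugate
-- hooks around it changes the size by any large odd number, or by any large even
-- number if two are used, and does not change the content sum.

module Submission where

open import Defs
open import Data.Bool using (true; false)
open import Data.Fin using (Fin; zero; suc; toℕ)
open import Data.Fin.Permutation.Components using (transpose)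
open import Data.Fin.Properties as Finₚ using (_≟_)
open import Data.Integer using (ℤ; +_; _+_; _*_; -_; _-_; 0ℤ; 1ℤ)
import Data.Integer.Properties as ℤₚ
open import Data.Integer.Tactic.RingSolver using (solve-∀)
open import Data.List using (List; []; _∷_; _++_; length; take; drop; map; replicate; foldr)
open import Data.List using (filter; concatMap; tabulate; allFin)
import Data.List.Properties as Listₚ
open import Data.List.Relation.Unary.All as All using (All; []; _∷_)
import Data.List.Relation.Unary.All.Properties as All
open import Data.List.Relation.Unary.AllPairs using (AllPairs; []; _∷_)
open import Data.List.Relation.Unary.Unique.Propositional using (Unique)
import Data.List.Relation.Unary.Unique.Propositional.Properties as Unique
open import Data.Nat as ℕ using (ℕ; zero; suc; _≤_)
open import Data.Nat.ListAction using (sum)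
import Data.Nat.Properties as ℕₚ
open import Data.Nat.Tactic.RingSolver using () renaming (solve-∀ to ℕ-solve-∀)
open import Data.Product using (∃; ∃₂; _×_; _,_; proj₁; proj₂)
open import Data.Rational as ℚ using (_/_)
open import Data.Rational.Literals using (fromℤ)
import Data.Rational.Properties as ℚₚ
open import Data.Sum using (_⊎_; inj₁; inj₂; [_,_]′)
open import Data.Vec as Vec using (Vec)
open import Data.Vec.Functional using (updateAt)
open import Data.Vec.Functional.Properties using (updateAt-updates; updateAt-minimal)
import Data.Vec.Properties as Vecₚ
open import Relation.Binary.PropositionalEquality
open import Relation.Nullary using (Dec; yes; no; does)

open ≡-Reasoning

private
  variable
    A : Set

-- Sums over positions and over swaps of a list

-- The summand receives the whole decomposition, so it can rebuild the list with the entry replaced.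
Σpos : (List A → A → List A → ℤ) → List A → ℤ
Σpos h []       = 0ℤ
Σpos h (x ∷ xs) = h [] x xs + Σpos (λ l → h (x ∷ l)) xs

Σswap : (List A → ℤ) → List A → ℤ
Σswap g []       = 0ℤ
Σswap g (x ∷ xs) = Σpos (λ l a r → g (a ∷ l ++ x ∷ r)) xs + Σswap (λ ys → g (x ∷ ys)) xs

Σpos-cong : ∀ {h k : List A → A → List A → ℤ} xs →
            (∀ l a r → xs ≡ l ++ a ∷ r → h l a r ≡ k l a r) → Σpos h xs ≡ Σpos k xs
Σpos-cong []       eq = refl
Σpos-cong (x ∷ xs) eq = cong₂ _+_ (eq [] x xs refl)
  (Σpos-cong xs λ l a r e → eq (x ∷ l) a r (cong (x ∷_) e))

Σpos-+ : ∀ (h k : List A → A → List A → ℤ) xs →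
         Σpos (λ l a r → h l a r + k l a r) xs ≡ Σpos h xs + Σpos k xs
Σpos-+ h k []       = refl
Σpos-+ h k (x ∷ xs) = trans (cong (_+_ (h [] x xs + k [] x xs)) (Σpos-+ (λ l → h (x ∷ l)) (λ l → k (x ∷ l)) xs))
  (interchange (h [] x xs) (k [] x xs) _ _)
  where
  interchange : ∀ a b c d → (a + b) + (c + d) ≡ (a + c) + (b + d)
  interchange = solve-∀

Σpos-* : ∀ z (h : List A → A → List A → ℤ) xs →
         Σpos (λ l a r → z * h l a r) xs ≡ z * Σpos h xs
Σpos-* z h []       = sym (ℤₚ.*-zeroʳ z)
Σpos-* z h (x ∷ xs) = trans (cong (_+_ (z * h [] x xs)) (Σpos-* z (λ l → h (x ∷ l)) xs))
  (sym (ℤₚ.*-distribˡ-+ z _ _))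

Σpos-const : ∀ z (xs : List A) → Σpos (λ _ _ _ → z) xs ≡ + length xs * z
Σpos-const z []       = sym (ℤₚ.*-zeroˡ z)
Σpos-const z (x ∷ xs) = trans (cong (_+_ z) (Σpos-const z xs)) (step (+ length xs) z)
  where
  step : ∀ n z → z + n * z ≡ (1ℤ + n) * z
  step = solve-∀

Σpos-++ : ∀ (h : List A → A → List A → ℤ) xs ys →
          Σpos h (xs ++ ys) ≡ Σpos (λ l a r → h l a (r ++ ys)) xs + Σpos (λ l → h (xs ++ l)) ys
Σpos-++ h []       ys = sym (ℤₚ.+-identityˡ _)
Σpos-++ h (x ∷ xs) ys = trans (cong (_+_ (h [] x (xs ++ ys))) (Σpos-++ (λ l → h (x ∷ l)) xs ys))
  (sym (ℤₚ.+-assoc (h [] x (xs ++ ys)) _ _))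

length-replace : ∀ (l : List A) {a b r} → length (l ++ a ∷ r) ≡ length (l ++ b ∷ r)
length-replace l = trans (Listₚ.length-++ l) (sym (Listₚ.length-++ l))

Σswap-cong : ∀ {g h : List A → ℤ} xs → (∀ ys → length ys ≡ length xs → g ys ≡ h ys) → Σswap g xs ≡ Σswap h xs
Σswap-cong []       eq = refl
Σswap-cong (x ∷ xs) eq = cong₂ _+_
  (Σpos-cong xs λ l a r e → eq _ (cong suc (trans (length-replace l) (cong length (sym e)))))
  (Σswap-cong xs λ ys e → eq (x ∷ ys) (cong suc e))

Σswap-* : ∀ z (g : List A → ℤ) xs → Σswap (λ ys → z * g ys) xs ≡ z * Σswap g xs
Σswap-* z g []       = sym (ℤₚ.*-zeroʳ z)
Σswap-* z g (x ∷ xs) = trans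
  (cong₂ _+_ (Σpos-* z _ xs) (Σswap-* z _ xs))
  (sym (ℤₚ.*-distribˡ-+ z _ _))

-- For a fixed entry `b` of the second list, the inner sum has the form that `lagrange` evaluates.
Σcross : (List A → List A → ℤ) → List A → List A → ℤ
Σcross g xs ys = Σpos (λ l′ b r′ → Σpos (λ l a r → g (l ++ b ∷ r) (l′ ++ a ∷ r′)) xs) ys

-- A swap lies in the first block, crosses, or lies in the second block. The hypothesis on `f` fixes
-- the length of the first block, because columns are cut off by `take` and `drop` at a fixed place.
Σswap-++ : ∀ (g : List A → List A → ℤ) (f : List A → ℤ) xs ys →
           (∀ us vs → length us ≡ length xs → f (us ++ vs) ≡ g us vs) →
           Σswap f (xs ++ ys) ≡ Σswap (λ us → g us ys) xs + (Σcross g xs ys + Σswap (g xs) ys)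
Σswap-++ g f [] ys eq = begin
  Σswap f ys                    ≡⟨ Σswap-cong ys (λ vs _ → eq [] vs refl) ⟩
  Σswap (g []) ys               ≡⟨ ring _ ⟩
  0ℤ + (0ℤ + Σswap (g []) ys)   ≡⟨ cong (λ z → 0ℤ + (z + Σswap (g []) ys)) (ℤₚ.*-zeroʳ (+ length ys)) ⟨
  0ℤ + (+ length ys * 0ℤ + Σswap (g []) ys)   ≡⟨ cong (λ z → 0ℤ + (z + Σswap (g []) ys)) (Σpos-const 0ℤ ys) ⟨
  0ℤ + (Σcross g [] ys + Σswap (g []) ys) ∎
  where
  ring : ∀ z → z ≡ 0ℤ + (0ℤ + z)
  ring = solve-∀
Σswap-++ g f (x ∷ xs) ys eq = begin
  Σpos (λ l a r → f (a ∷ l ++ x ∷ r)) (xs ++ ys) + Σswap (λ zs → f (x ∷ zs)) (xs ++ ys)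
    ≡⟨ cong₂ _+_ (Σpos-++ _ xs ys)
         (Σswap-++ (λ us → g (x ∷ us)) (λ zs → f (x ∷ zs)) xs ys λ us vs e → eq (x ∷ us) vs (cong suc e)) ⟩
  (Σpos (λ l a r → f (a ∷ l ++ x ∷ (r ++ ys))) xs + Σpos (λ l a r → f (a ∷ (xs ++ l) ++ x ∷ r)) ys)
    + (s₁ + (s₂ + s₃))
    ≡⟨ cong (_+ (s₁ + (s₂ + s₃))) (cong₂ _+_
        (Σpos-cong xs λ l a r e → trans (cong (λ zs → f (a ∷ zs)) (sym (Listₚ.++-assoc l (x ∷ r) ys)))
           (eq (a ∷ l ++ x ∷ r) ys (cong suc (trans (length-replace l) (cong length (sym e))))))
        (Σpos-cong ys λ l a r _ → trans (cong (λ zs → f (a ∷ zs)) (Listₚ.++-assoc xs l (x ∷ r)))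
           (eq (a ∷ xs) (l ++ x ∷ r) refl))) ⟩
  (t₁ + t₂) + (s₁ + (s₂ + s₃))
    ≡⟨ ring t₁ t₂ s₁ s₂ s₃ ⟩
  (t₁ + s₁) + ((t₂ + s₂) + s₃)
    ≡⟨ cong (λ z → (t₁ + s₁) + (z + s₃)) (sym (Σpos-+ _ _ ys)) ⟩
  Σswap (λ us → g us ys) (x ∷ xs) + (Σcross g (x ∷ xs) ys + Σswap (g (x ∷ xs)) ys) ∎
  where
  s₁ = Σswap (λ us → g (x ∷ us) ys) xs
  s₂ = Σcross (λ us → g (x ∷ us)) xs ys
  s₃ = Σswap (g (x ∷ xs)) ys
  t₁ = Σpos (λ l a r → g (a ∷ l ++ x ∷ r) ys) xs
  t₂ = Σpos (λ l a r → g (a ∷ xs) (l ++ x ∷ r)) ys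
  ring : ∀ t₁ t₂ s₁ s₂ s₃ → (t₁ + t₂) + (s₁ + (s₂ + s₃)) ≡ (t₁ + s₁) + ((t₂ + s₂) + s₃)
  ring = solve-∀

-- Polynomial functions and Lagrange interpolation

-- Degree below `d`: the index counts Horner coefficients, and `Poly 0` is the zero function. The
-- bound in `lagrange` is thus the number of nodes.
data Poly : ℕ → (ℤ → ℤ) → Set where
  vanishing : ∀ {f} → (∀ t → f t ≡ 0ℤ) → Poly 0 f
  horner    : ∀ {d f} a g → Poly d g → (∀ t → f t ≡ a + t * g t) → Poly (suc d) f

Poly-resp : ∀ {d f g} → (∀ t → g t ≡ f t) → Poly d f → Poly d g
Poly-resp eq (vanishing z)    = vanishing λ t → trans (eq t) (z t)
Poly-resp eq (horner a h p e) = horner a h p λ t → trans (eq t) (e t)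

Poly-suc : ∀ {d f} → Poly d f → Poly (suc d) f
Poly-suc {f = f} (vanishing z) = horner 0ℤ f (vanishing z) λ t →
  trans (z t) (sym (trans (cong (λ w → 0ℤ + t * w) (z t)) (ring t)))
  where
  ring : ∀ t → 0ℤ + t * 0ℤ ≡ 0ℤ
  ring = solve-∀
Poly-suc (horner a g p e) = horner a g (Poly-suc p) e

Poly-≤ : ∀ {d d′ f} → d ≤ d′ → Poly d f → Poly d′ f
Poly-≤ {d′ = zero}  ℕ.z≤n p = p
Poly-≤ {d′ = suc _} ℕ.z≤n p = Poly-suc (Poly-≤ ℕ.z≤n p)
Poly-≤ (ℕ.s≤s d≤d′) (horner a g p e) = horner a g (Poly-≤ d≤d′ p) e

Poly-* : ∀ {d f} z → Poly d f → Poly d (λ t → z * f t)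
Poly-* z (vanishing e) = vanishing λ t → trans (cong (z *_) (e t)) (ℤₚ.*-zeroʳ z)
Poly-* z (horner a g p e) = horner (z * a) (λ t → z * g t) (Poly-* z p) λ t →
  trans (cong (z *_) (e t)) (ring z a t (g t))
  where
  ring : ∀ z a t w → z * (a + t * w) ≡ z * a + t * (z * w)
  ring = solve-∀

Poly-linear : ∀ {d f} a b → Poly d f → Poly (suc d) (λ t → a + (t - b) * f t)
Poly-linear {f = f} a b (vanishing z) = horner a f (vanishing z) λ t →
  trans (cong (λ w → a + (t - b) * w) (z t)) (trans (ring a b t) (cong (λ w → a + t * w) (sym (z t))))
  where
  ring : ∀ a b t → a + (t - b) * 0ℤ ≡ a + t * 0ℤ
  ring = solve-∀
Poly-linear {f = f} a b (horner a′ g p e) =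
  horner (a - b * a′) (λ t → a′ + (t - b) * g t) (Poly-linear a′ b p) λ t →
    trans (cong (λ w → a + (t - b) * w) (e t)) (ring a b a′ t (g t))
  where
  ring : ∀ a b a′ t w → a + (t - b) * (a′ + t * w) ≡ (a - b * a′) + t * (a′ + (t - b) * w)
  ring = solve-∀

-- Synthetic division by `t - s`: the remainder is the value at `s`, and the degree bound drops by
-- one.
Poly-divide : ∀ {d f} → Poly (suc d) f → ∀ s →
              ∃ λ q → Poly d q × (∀ t → f t ≡ f s + (t - s) * q t)
Poly-divide (horner a g (vanishing z) e) s = g , vanishing z , λ t →
  trans (e t) (trans (cong (λ w → a + t * w) (z t))
    (trans (ring a s t) (sym (cong₂ _+_ (trans (e s) (cong (λ w → a + s * w) (z s))) (cong ((t - s) *_) (z t))))))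
  where
  ring : ∀ a s t → a + t * 0ℤ ≡ (a + s * 0ℤ) + (t - s) * 0ℤ
  ring = solve-∀
Poly-divide (horner a g p@(horner _ _ _ _) e) s with Poly-divide p s
... | h , ph , eh = (λ t → g s + t * h t) , horner (g s) h ph (λ _ → refl) , λ t →
  trans (e t) (trans (cong (λ w → a + t * w) (eh t))
    (trans (ring a s t (g s) (h t)) (cong (λ w → w + (t - s) * (g s + t * h t)) (sym (e s)))))
  where
  ring : ∀ a s t w v → a + t * (w + (t - s) * v) ≡ (a + s * w) + (t - s) * (w + t * v)
  ring = solve-∀

-- Vandermonde products: sign under swaps and degree

diffs : ℤ → List ℤ → ℤ
diffs x []       = 1ℤ
diffs x (b ∷ bs) = (x - b) * diffs x bs

vandermonde : List ℤ → ℤ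
vandermonde []       = 1ℤ
vandermonde (x ∷ xs) = diffs x xs * vandermonde xs

diffs-insert : ∀ x l a r → diffs x (l ++ a ∷ r) ≡ (x - a) * diffs x (l ++ r)
diffs-insert x []      a r = refl
diffs-insert x (b ∷ l) a r = trans (cong ((x - b) *_) (diffs-insert x l a r)) (ring (x - b) (x - a) _)
  where
  ring : ∀ u v w → u * (v * w) ≡ v * (u * w)
  ring = solve-∀

diffs-swap : ∀ x a l b r → diffs x (a ∷ l ++ b ∷ r) ≡ diffs x (b ∷ l ++ a ∷ r)
diffs-swap x a l b r = trans (cong ((x - a) *_) (diffs-insert x l b r))
  (trans (ring (x - a) (x - b) _) (cong ((x - b) *_) (sym (diffs-insert x l a r))))
  where
  ring : ∀ u v w → u * (v * w) ≡ v * (u * w)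
  ring = solve-∀

-- An entry `c` between the two contributes `(a - c) * (c - b)`, which equals `(b - c) * (c - a)`;
-- hence only the factor `a - b` changes its sign.
vandermonde-swap : ∀ a l b r → vandermonde (a ∷ l ++ b ∷ r) ≡ - vandermonde (b ∷ l ++ a ∷ r)
vandermonde-swap a []      b r = ring a b (diffs a r) (diffs b r) (vandermonde r)
  where
  ring : ∀ a b u v w → (a - b) * u * (v * w) ≡ - ((b - a) * v * (u * w))
  ring = solve-∀
vandermonde-swap a (c ∷ l) b r = begin
  (a - c) * diffs a lb * (diffs c lb * vandermonde lb)
    ≡⟨ cong (λ w → (a - c) * diffs a lb * (w * vandermonde lb)) (diffs-insert c l b r) ⟩
  (a - c) * diffs a lb * ((c - b) * k * vandermonde lb)
    ≡⟨ ring₁ (a - c) (diffs a lb) (c - b) k (vandermonde lb) ⟩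
  (a - c) * ((c - b) * k) * (diffs a lb * vandermonde lb)
    ≡⟨ cong ((a - c) * ((c - b) * k) *_) (vandermonde-swap a l b r) ⟩
  (a - c) * ((c - b) * k) * - (diffs b la * vandermonde la)
    ≡⟨ ring₂ a b c k (diffs b la) (vandermonde la) ⟩
  - ((b - c) * diffs b la * ((c - a) * k * vandermonde la))
    ≡⟨ cong (λ w → - ((b - c) * diffs b la * (w * vandermonde la))) (sym (diffs-insert c l a r)) ⟩
  - ((b - c) * diffs b la * (diffs c la * vandermonde la)) ∎
  where
  la = l ++ a ∷ r
  lb = l ++ b ∷ r
  k  = diffs c (l ++ r)
  ring₁ : ∀ p q r s t → p * q * (r * s * t) ≡ p * (r * s) * (q * t)
  ring₁ = solve-∀
  ring₂ : ∀ a b c k u v → (a - c) * ((c - b) * k) * - (u * v) ≡ - ((b - c) * u * ((c - a) * k * v))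
  ring₂ = solve-∀

diffs-Poly : ∀ r → Poly (suc (length r)) (λ t → diffs t r)
diffs-Poly []      = horner 1ℤ (λ _ → 0ℤ) (vanishing λ _ → refl) ring
  where
  ring : ∀ t → 1ℤ ≡ 1ℤ + t * 0ℤ
  ring = solve-∀
diffs-Poly (b ∷ r) = Poly-resp (λ _ → sym (ℤₚ.+-identityˡ _)) (Poly-linear 0ℤ b (diffs-Poly r))

-- The entry `t` meets every other entry in one linear factor, so the degree is one less than the
-- length; `0ℤ` holds the place of `t` in the length.
vandermonde-Poly : ∀ l r → Poly (length (l ++ 0ℤ ∷ r)) (λ t → vandermonde (l ++ t ∷ r))
vandermonde-Poly []      r = Poly-resp (λ t → ℤₚ.*-comm (diffs t r) _) (Poly-* (vandermonde r) (diffs-Poly r))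
vandermonde-Poly (x ∷ l) r =
  Poly-resp (λ t → trans (cong (_* vandermonde (l ++ t ∷ r)) (diffs-insert x l t r))
                    (ring x t (diffs x (l ++ r)) (vandermonde (l ++ t ∷ r))))
    (Poly-* (- diffs x (l ++ r)) (Poly-linear 0ℤ x (vandermonde-Poly l r)))
  where
  ring : ∀ x t k v → (x - t) * k * v ≡ - k * (0ℤ + (t - x) * v)
  ring = solve-∀

-- The divided difference (diffs x l − diffs t l) / (x − t).
dividedDiff : ℤ → List ℤ → ℤ → ℤ
dividedDiff x []      t = 0ℤ
dividedDiff x (b ∷ l) t = diffs x l + (t - b) * dividedDiff x l t

dividedDiff-Poly : ∀ x l → Poly (length l) (dividedDiff x l)
dividedDiff-Poly x []      = vanishing λ _ → refl
dividedDiff-Poly x (b ∷ l) = Poly-linear (diffs x l) b (dividedDiff-Poly x l)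

dividedDiff-spec : ∀ x l t → (x - t) * dividedDiff x l t ≡ diffs x l - diffs t l
dividedDiff-spec x []      t = ℤₚ.*-zeroʳ (x - t)
dividedDiff-spec x (b ∷ l) t = trans (ring₁ x t b (diffs x l) (dividedDiff x l t))
  (trans (cong (λ w → (x - t) * diffs x l + (t - b) * w) (dividedDiff-spec x l t))
    (ring₂ x t b (diffs x l) (diffs t l)))
  where
  ring₁ : ∀ x t b p q → (x - t) * (p + (t - b) * q) ≡ (x - t) * p + (t - b) * ((x - t) * q)
  ring₁ = solve-∀
  ring₂ : ∀ x t b p q → (x - t) * p + (t - b) * (p - q) ≡ (x - b) * p - (t - b) * q
  ring₂ = solve-∀

-- At the root `a` the divided difference is `diffs x` with the factor `x - a` removed. Induction on
-- `l` avoids cancelling that factor, which may be zero.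
dividedDiff-root : ∀ x l a r → dividedDiff x (l ++ a ∷ r) a ≡ diffs x (l ++ r)
dividedDiff-root x []      a r = ring a (diffs x r) (dividedDiff x r a)
  where
  ring : ∀ a p q → p + (a - a) * q ≡ p
  ring = solve-∀
dividedDiff-root x (b ∷ l) a r = trans
  (cong₂ (λ p q → p + (a - b) * q) (diffs-insert x l a r) (dividedDiff-root x l a r))
  (ring x a b (diffs x (l ++ r)))
  where
  ring : ∀ x a b p → (x - a) * p + (a - b) * p ≡ (x - b) * p
  ring = solve-∀

-- Divided by `vandermonde us`, the factor `vandermonde (l ++ y ∷ r)` is the Lagrange basis
-- polynomial of the node `a` at `y`; without denominators, repeated nodes are covered too. The
-- induction divides `w` by `t - x` and applies the claim for the remaining nodes to the quotient
-- `q` and to the divided difference `d`.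
lagrange : ∀ us {w} → Poly (length us) w → ∀ y →
           Σpos (λ l a r → vandermonde (l ++ y ∷ r) * w a) us ≡ vandermonde us * w y
lagrange [] (vanishing z) y = sym (cong (1ℤ *_) (z y))
lagrange (x ∷ us) {w} p y with Poly-divide p x
... | q , pq , eq = begin
  vandermonde (y ∷ us) * w x + Σpos (λ l a r → vandermonde (x ∷ l ++ y ∷ r) * w a) us
    ≡⟨ cong (_+_ (vandermonde (y ∷ us) * w x)) (trans (Σpos-cong us termwise) (Σpos-+ _ _ us)) ⟩
  vandermonde (y ∷ us) * w x
    + (Σpos (λ l a r → (w x * (x - y)) * (vandermonde (l ++ y ∷ r) * d a)) us
       + Σpos (λ l a r → ((y - x) * diffs x us) * (vandermonde (l ++ y ∷ r) * q a)) us)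
    ≡⟨ cong (_+_ (vandermonde (y ∷ us) * w x)) (cong₂ _+_
         (trans (Σpos-* (w x * (x - y)) _ us) (cong ((w x * (x - y)) *_) (lagrange us (dividedDiff-Poly x us) y)))
         (trans (Σpos-* ((y - x) * diffs x us) _ us) (cong (((y - x) * diffs x us) *_) (lagrange us pq y)))) ⟩
  diffs y us * v * w x + ((w x * (x - y)) * (v * d y) + ((y - x) * diffs x us) * (v * q y))
    ≡⟨ ring₁ (diffs y us) v (w x) (x - y) (d y) _ ⟩
  v * (w x * (diffs y us + (x - y) * d y)) + ((y - x) * diffs x us) * (v * q y)
    ≡⟨ cong (λ z → v * (w x * (diffs y us + z)) + ((y - x) * diffs x us) * (v * q y)) (dividedDiff-spec x us y) ⟩
  v * (w x * (diffs y us + (diffs x us - diffs y us))) + ((y - x) * diffs x us) * (v * q y)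
    ≡⟨ ring₂ v (w x) (diffs x us) (diffs y us) (y - x) (q y) ⟩
  diffs x us * v * (w x + (y - x) * q y)
    ≡⟨ cong (diffs x us * v *_) (sym (eq y)) ⟩
  vandermonde (x ∷ us) * w y ∎
  where
  v = vandermonde us
  d = dividedDiff x us
  ring₀ : ∀ x y a k v w q →
          (x - y) * k * v * (w + (a - x) * q) ≡ (w * (x - y)) * (v * k) + ((y - x) * ((x - a) * k)) * (v * q)
  ring₀ = solve-∀
  ring₁ : ∀ p v w z d s → p * v * w + ((w * z) * (v * d) + s) ≡ v * (w * (p + z * d)) + s
  ring₁ = solve-∀
  ring₂ : ∀ v w p p′ z q → v * (w * (p′ + (p - p′))) + (z * p) * (v * q) ≡ p * v * (w + z * q)
  ring₂ = solve-∀
  -- The factor `diffs x (l ++ r)` lacks the node `a`. In the first summand it is `d a`; in the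
  -- second, `x - a` completes it to `diffs x us`, the same for all `a`.
  termwise : ∀ l a r → us ≡ l ++ a ∷ r →
             vandermonde (x ∷ l ++ y ∷ r) * w a
             ≡ (w x * (x - y)) * (vandermonde (l ++ y ∷ r) * d a)
               + ((y - x) * diffs x us) * (vandermonde (l ++ y ∷ r) * q a)
  termwise l a r refl = begin
    diffs x (l ++ y ∷ r) * v′ * w a
      ≡⟨ cong₂ (λ z z′ → z * v′ * z′) (diffs-insert x l y r) (eq a) ⟩
    (x - y) * diffs x (l ++ r) * v′ * (w x + (a - x) * q a)
      ≡⟨ ring₀ x y a (diffs x (l ++ r)) v′ (w x) (q a) ⟩
    (w x * (x - y)) * (v′ * diffs x (l ++ r)) + ((y - x) * ((x - a) * diffs x (l ++ r))) * (v′ * q a)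
      ≡⟨ cong₂ (λ z z′ → (w x * (x - y)) * (v′ * z) + ((y - x) * z′) * (v′ * q a))
           (dividedDiff-root x l a r) (diffs-insert x l a r) ⟨
    (w x * (x - y)) * (v′ * d a) + ((y - x) * diffs x us) * (v′ * q a) ∎
    where v′ = vandermonde (l ++ y ∷ r)

-- Specht polynomials are eigenvectors of the sum of all swaps

-- The binomial coefficient n(n - 1)/2.
pairs : ℕ → ℕ
pairs zero    = 0
pairs (suc n) = n ℕ.+ pairs n

-- `diffs x` is symmetric in the list, so it is constant under the swaps. The induction absorbs the
-- factor `x - y` into `g`.
Σswap-diffs : ∀ x g xs → Σswap (λ ys → diffs x ys * g ys) xs ≡ diffs x xs * Σswap g xs
Σswap-diffs x g []       = refl
Σswap-diffs x g (y ∷ ys) = begin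
  Σpos (λ l a r → diffs x (a ∷ l ++ y ∷ r) * g (a ∷ l ++ y ∷ r)) ys
    + Σswap (λ zs → (x - y) * diffs x zs * g (y ∷ zs)) ys
    ≡⟨ cong₂ _+_
         (trans (Σpos-cong ys λ { l a r refl → cong (_* g (a ∷ l ++ y ∷ r)) (diffs-swap x a l y r) })
                (Σpos-* (diffs x (y ∷ ys)) _ ys))
         (trans (Σswap-cong ys λ zs _ → ring (x - y) (diffs x zs) (g (y ∷ zs)))
                (Σswap-diffs x (λ zs → (x - y) * g (y ∷ zs)) ys)) ⟩
  (x - y) * diffs x ys * s₁ + diffs x ys * Σswap (λ zs → (x - y) * g (y ∷ zs)) ys
    ≡⟨ cong (λ z → (x - y) * diffs x ys * s₁ + diffs x ys * z) (Σswap-* (x - y) _ ys) ⟩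
  (x - y) * diffs x ys * s₁ + diffs x ys * ((x - y) * s₂)
    ≡⟨ collect (x - y) (diffs x ys) s₁ s₂ ⟩
  (x - y) * diffs x ys * (s₁ + s₂) ∎
  where
  s₁ = Σpos (λ l a r → g (a ∷ l ++ y ∷ r)) ys
  s₂ = Σswap (λ zs → g (y ∷ zs)) ys
  ring : ∀ u v w → u * v * w ≡ v * (u * w)
  ring = solve-∀
  collect : ∀ u v s t → u * v * s + v * (u * t) ≡ u * v * (s + t)
  collect = solve-∀

Σswap-vandermonde : ∀ xs → Σswap vandermonde xs ≡ - + pairs (length xs) * vandermonde xs
Σswap-vandermonde []       = refl
Σswap-vandermonde (x ∷ xs) = begin
  Σpos (λ l a r → vandermonde (a ∷ l ++ x ∷ r)) xs + Σswap (λ ys → diffs x ys * vandermonde ys) xs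
    ≡⟨ cong₂ _+_
         (trans (Σpos-cong xs λ { l a r refl → vandermonde-swap a l x r }) (Σpos-const _ xs))
         (trans (Σswap-diffs x vandermonde xs) (cong (diffs x xs *_) (Σswap-vandermonde xs))) ⟩
  + length xs * - (diffs x xs * v) + diffs x xs * (- + pairs (length xs) * v)
    ≡⟨ ring (+ length xs) (+ pairs (length xs)) (diffs x xs) v ⟩
  - (+ length xs + + pairs (length xs)) * (diffs x xs * v) ∎
  where
  v = vandermonde xs
  ring : ∀ n p d v → n * - (d * v) + d * (- p * v) ≡ - (n + p) * (d * v)
  ring = solve-∀

-- The columns of a tableau are consecutive blocks of the list.
specht : List ℕ → List ℤ → ℤ
specht []       xs = 1ℤ
specht (c ∷ cs) xs = vandermonde (take c xs) * specht cs (drop c xs)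

-- The sum of the contents of the partition with column lengths cs.
content : List ℕ → ℤ
content []       = 0ℤ
content (c ∷ cs) = + sum cs - + pairs c + content cs

Descending : List ℕ → Set
Descending = AllPairs ℕ._≥_

-- The changed position lies in the column or behind it. The case and the surrounding lists are
-- independent of `t`, as a polynomial in `t` requires.
take-drop-focus : ∀ c (l r : List A) →
  (∃₂ λ r₁ r₂ → ∀ t → take c (l ++ t ∷ r) ≡ l ++ t ∷ r₁ × drop c (l ++ t ∷ r) ≡ r₂) ⊎
  (∃₂ λ l₁ l₂ → ∀ t → take c (l ++ t ∷ r) ≡ l₁ × drop c (l ++ t ∷ r) ≡ l₂ ++ t ∷ r)
take-drop-focus zero    l       r = inj₂ ([] , l , λ _ → refl , refl)
take-drop-focus (suc c) []      r = inj₁ (take c r , drop c r , λ _ → refl , refl)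
take-drop-focus (suc c) (x ∷ l) r with take-drop-focus c l r
... | inj₁ (r₁ , r₂ , e) = inj₁ (r₁ , r₂ , λ t → cong (x ∷_) (proj₁ (e t)) , proj₂ (e t))
... | inj₂ (l₁ , l₂ , e) = inj₂ (x ∷ l₁ , l₂ , λ t → cong (x ∷_) (proj₁ (e t)) , proj₂ (e t))

length-drop-sum : ∀ c cs (xs : List A) → length xs ≡ sum (c ∷ cs) → length (drop c xs) ≡ sum cs
length-drop-sum c cs xs len = trans (Listₚ.length-drop c xs) (trans (cong (ℕ._∸ c) len) (ℕₚ.m+n∸m≡n c (sum cs)))

-- An entry lies in one column only, and that column has length at most `d`.
specht-Poly : ∀ {d} cs → All (_≤ d) cs → ∀ l r → length (l ++ 0ℤ ∷ r) ≡ sum cs →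
              Poly d (λ t → specht cs (l ++ t ∷ r))
specht-Poly []       _           []      r ()
specht-Poly []       _           (_ ∷ _) r ()
specht-Poly (c ∷ cs) (c≤d ∷ all) l r len with take-drop-focus c l r
... | inj₁ (r₁ , r₂ , e) = Poly-resp
  (λ t → trans (cong₂ (λ us vs → vandermonde us * specht cs vs) (proj₁ (e t)) (proj₂ (e t)))
               (ℤₚ.*-comm (vandermonde (l ++ t ∷ r₁)) _))
  (Poly-* (specht cs r₂) (Poly-≤ (ℕₚ.≤-trans column≤c c≤d) (vandermonde-Poly l r₁)))
  where
  column≤c : length (l ++ 0ℤ ∷ r₁) ≤ c
  column≤c = subst (_≤ c) (trans (sym (Listₚ.length-take c (l ++ 0ℤ ∷ r))) (cong length (proj₁ (e 0ℤ)))) (ℕₚ.m⊓n≤m c _)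
... | inj₂ (l₁ , l₂ , e) = Poly-resp
  (λ t → cong₂ (λ us vs → vandermonde us * specht cs vs) (proj₁ (e t)) (proj₂ (e t)))
  (Poly-* (vandermonde l₁) (specht-Poly cs all l₂ r
    (trans (cong length (sym (proj₂ (e 0ℤ)))) (length-drop-sum c cs (l ++ 0ℤ ∷ r) len))))

take-length-++ : ∀ {c} (us vs : List A) → length us ≡ c → take c (us ++ vs) ≡ us × drop c (us ++ vs) ≡ vs
take-length-++ []       vs refl = refl , refl
take-length-++ (u ∷ us) vs refl = cong (u ∷_) (proj₁ rec) , proj₂ rec
  where rec = take-length-++ us vs refl

-- Swaps within the first column contribute `- pairs c`. Each of the `sum cs` entries behind it
-- contributes 1 through its swaps with that column. Swaps among those entries are covered by
-- induction.
Σswap-specht : ∀ cs → Descending cs → ∀ xs → length xs ≡ sum cs →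
               Σswap (specht cs) xs ≡ content cs * specht cs xs
Σswap-specht []       _            []       _   = refl
Σswap-specht (c ∷ cs) (cs≤c ∷ desc) xs len = begin
  Σswap (specht (c ∷ cs)) xs
    ≡⟨ cong (Σswap (specht (c ∷ cs))) (sym (Listₚ.take++drop≡id c xs)) ⟩
  Σswap (specht (c ∷ cs)) (us ++ vs)
    ≡⟨ Σswap-++ (λ us vs → vandermonde us * specht cs vs) _ us vs (λ us′ vs′ e →
         let e₁ , e₂ = take-length-++ us′ vs′ (trans e len-us) in
         cong₂ (λ p q → vandermonde p * specht cs q) e₁ e₂) ⟩
  Σswap (λ us → vandermonde us * f) us
    + (Σcross (λ us vs → vandermonde us * specht cs vs) us vs + Σswap (λ vs → v * specht cs vs) vs)
    ≡⟨ cong₂ _+_ inside (cong₂ _+_ across outside) ⟩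
  f * (- + pairs c * v) + (+ sum cs * (v * f) + v * (content cs * f))
    ≡⟨ ring f (+ pairs c) v (+ sum cs) (content cs) ⟩
  (+ sum cs - + pairs c + content cs) * (v * f) ∎
  where
  us = take c xs
  vs = drop c xs
  v  = vandermonde us
  f  = specht cs vs
  len-us : length us ≡ c
  len-us = trans (Listₚ.length-take c xs) (ℕₚ.m≤n⇒m⊓n≡m (subst (c ≤_) (sym len) (ℕₚ.m≤m+n c (sum cs))))
  len-vs : length vs ≡ sum cs
  len-vs = length-drop-sum c cs xs len
  inside : Σswap (λ us → vandermonde us * f) us ≡ f * (- + pairs c * v)
  inside = trans (Σswap-cong us λ ys _ → ℤₚ.*-comm (vandermonde ys) f)
    (trans (Σswap-* f vandermonde us)
      (cong (f *_) (trans (Σswap-vandermonde us) (cong (λ k → - + pairs k * v) len-us))))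
  outside : Σswap (λ vs → v * specht cs vs) vs ≡ v * (content cs * f)
  outside = trans (Σswap-* v (specht cs) vs) (cong (v *_) (Σswap-specht cs desc vs len-vs))
  -- Seen as a function of the entry moved out of the longer column us, the
  -- remaining factor has degree < c, so Lagrange interpolation applies.
  across : Σcross (λ us vs → vandermonde us * specht cs vs) us vs ≡ + sum cs * (v * f)
  across = trans (Σpos-cong vs λ l b r e → trans
      (lagrange us (subst (λ d → Poly d (λ t → specht cs (l ++ t ∷ r))) (sym len-us)
        (specht-Poly cs cs≤c l r (trans (trans (length-replace l) (cong length (sym e))) len-vs))) b)
      (cong (λ ys → v * specht cs ys) (sym e)))
    (trans (Σpos-const (v * f) vs) (cong (λ k → + k * (v * f)) len-vs))
  ring : ∀ f p v s k → f * (- p * v) + (s * (v * f) + v * (k * f)) ≡ (s - p + k) * (v * f)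
  ring = solve-∀

-- Nonvanishing at distinct entries

*-≢0 : ∀ {i j} → i ≢ 0ℤ → j ≢ 0ℤ → i * j ≢ 0ℤ
*-≢0 {i} i≢0 j≢0 eq = [ i≢0 , j≢0 ]′ (ℤₚ.i*j≡0⇒i≡0∨j≡0 i eq)

diffs-≢0 : ∀ {x xs} → All (x ≢_) xs → diffs x xs ≢ 0ℤ
diffs-≢0 []          = λ ()
diffs-≢0 (x≢b ∷ all) = *-≢0 (λ e → x≢b (ℤₚ.i-j≡0⇒i≡j _ _ e)) (diffs-≢0 all)

vandermonde-≢0 : ∀ {xs} → Unique xs → vandermonde xs ≢ 0ℤ
vandermonde-≢0 []           = λ ()
vandermonde-≢0 (x∉xs ∷ uxs) = *-≢0 (diffs-≢0 x∉xs) (vandermonde-≢0 uxs)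

specht-≢0 : ∀ cs {xs} → Unique xs → specht cs xs ≢ 0ℤ
specht-≢0 []       u = λ ()
specht-≢0 (c ∷ cs) u = *-≢0 (vandermonde-≢0 (Unique.take⁺ c u)) (specht-≢0 cs (Unique.drop⁺ c u))

-- Partitions with prescribed size and content sum

-- A partition wrapped in a hook, without its first column: the arm puts one cell on each column of
-- `cs` and extends `r` cells beyond them.
rim : List ℕ → ℕ → List ℕ
rim cs r = map suc cs ++ replicate r 1

sum-rim : ∀ cs r → sum (rim cs r) ≡ sum cs ℕ.+ (length cs ℕ.+ r)
sum-rim []       zero    = refl
sum-rim []       (suc r) = cong suc (sum-rim [] r)
sum-rim (c ∷ cs) r       = trans (cong (suc c ℕ.+_) (sum-rim cs r)) (ring c (sum cs) (length cs ℕ.+ r))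
  where
  ring : ∀ c s k → suc c ℕ.+ (s ℕ.+ k) ≡ (c ℕ.+ s) ℕ.+ suc k
  ring = ℕ-solve-∀

-- The old cells move down one row and lose 1 each. The new top row has contents 0, 1, 2, and so on.
content-rim : ∀ cs r → content (rim cs r) ≡ content cs - + sum cs + + pairs (length cs ℕ.+ r)
content-rim []       zero    = refl
content-rim []       (suc r) = trans
  (cong₂ (λ s k → + s - 0ℤ + k) (sum-rim [] r) (content-rim [] r))
  (ring (+ r) (+ pairs r))
  where
  ring : ∀ r p → r - 0ℤ + (0ℤ - 0ℤ + p) ≡ 0ℤ - 0ℤ + (r + p)
  ring = solve-∀
content-rim (c ∷ cs) r       = trans
  (cong₂ (λ s k → + s - + pairs (suc c) + k) (sum-rim cs r) (content-rim cs r))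
  (ring (+ sum cs) (+ (length cs ℕ.+ r)) (+ c) (+ pairs c) (content cs) (+ pairs (length cs ℕ.+ r)))
  where
  ring : ∀ s a c p k q → (s + a) - (c + p) + (k - s + q) ≡ (s - p + k) - (c + s) + (a + q)
  ring = solve-∀

-- A partition of n with content sum e, at most w columns and at most h rows.
record Shape (w h n : ℕ) (e : ℤ) : Set where
  field
    columns    : List ℕ
    descending : Descending columns
    width      : length columns ≤ w
    height     : All (_≤ h) columns
    size       : sum columns ≡ n
    contents   : content columns ≡ e

∅ : Shape 0 0 0 0ℤ
∅ = record { columns = [] ; descending = [] ; width = ℕ.z≤n ; height = [] ; size = refl ; contents = refl }

rim-descending : ∀ {cs} → Descending cs → ∀ r → Descending (rim cs r)
rim-descending {[]} _ zero    = []
rim-descending {[]} _ (suc r) = All.replicate⁺ r ℕₚ.≤-refl ∷ rim-descending {[]} [] r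
rim-descending {c ∷ cs} (cs≤c ∷ desc) r =
  All.++⁺ (All.map⁺ (All.map ℕ.s≤s cs≤c)) (All.replicate⁺ r (ℕ.s≤s ℕ.z≤n)) ∷ rim-descending desc r

-- Wrapping a hook with arm a and leg b around a partition moves its cells
-- along the diagonals, so their contents do not change.
hook : ∀ {w h n e} a b → w ≤ a → h ≤ b → Shape w h n e →
       Shape (suc a) (suc b) (suc (a ℕ.+ b ℕ.+ n)) (e + + pairs (suc a) - + pairs (suc b))
hook {w} {h} {n} {e} a b w≤a h≤b S = record
  { columns    = suc b ∷ rim cs r
  ; descending = rim≤ ∷ rim-descending S.descending r
  ; width      = ℕ.s≤s (ℕₚ.≤-reflexive (trans (Listₚ.length-++ (map suc cs))
                   (trans (cong₂ ℕ._+_ (Listₚ.length-map suc cs) (Listₚ.length-replicate r)) len+r)))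
  ; height     = ℕₚ.≤-refl ∷ rim≤
  ; size       = trans (cong (suc b ℕ.+_) sum≡) (ring₁ a b n)
  -- Every cell of the rim stands one column to the right of the new first column. For the `n` old
  -- cells this restores the 1 lost in `content-rim`.
  ; contents   = trans (cong₂ (λ s k → + s - + pairs (suc b) + k) sum≡
                   (trans (content-rim cs r) (cong₂ (λ s k → s + + pairs k) (cong₂ (λ x y → x - + y) S.contents S.size) len+r)))
                   (ring₂ (+ n) (+ a) (+ pairs (suc b)) e (+ pairs a))
  }
  where
  module S = Shape S
  cs = S.columns
  r  = a ℕ.∸ length cs
  len+r : length cs ℕ.+ r ≡ a
  len+r = ℕₚ.m+[n∸m]≡n (ℕₚ.≤-trans S.width w≤a)
  rim≤ : All (_≤ suc b) (rim cs r)
  rim≤ = All.++⁺ (All.map⁺ (All.map (λ c≤h → ℕ.s≤s (ℕₚ.≤-trans c≤h h≤b)) S.height)) (All.replicate⁺ r (ℕ.s≤s ℕ.z≤n))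
  sum≡ : sum (rim cs r) ≡ n ℕ.+ a
  sum≡ = trans (sum-rim cs r) (cong₂ ℕ._+_ S.size len+r)
  ring₁ : ∀ a b n → suc b ℕ.+ (n ℕ.+ a) ≡ suc (a ℕ.+ b ℕ.+ n)
  ring₁ = ℕ-solve-∀
  ring₂ : ∀ n a p e q → (n + a) - p + (e - n + q) ≡ e + (a + q) - p
  ring₂ = solve-∀

-- Equal arm and leg have opposite contents. The size grows by the odd number 2a + 1.
selfConjugateHook : ∀ {w h n e} a → w ≤ a → h ≤ a → Shape w h n e → Shape (suc a) (suc a) (suc (a ℕ.+ a ℕ.+ n)) e
selfConjugateHook {e = e} a w≤a h≤a S = subst (Shape _ _ _) (ring e (+ pairs (suc a))) (hook a a w≤a h≤a S)
  where
  ring : ∀ e p → e + p - p ≡ e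
  ring = solve-∀

-- The arm has contents 1, ..., m and the leg -1, ..., -(m - 1). For `m` equal to 0 the empty
-- partition takes the place of the hook.
core : ∀ m → Shape (suc m) m (m ℕ.+ m) (+ m)
core zero    = record { columns = [] ; descending = [] ; width = ℕ.z≤n ; height = [] ; size = refl ; contents = refl }
core (suc m) = subst₂ (Shape _ _) (ring₁ m) (ring₂ (+ m) (+ pairs (suc m))) (hook (suc m) m ℕ.z≤n ℕ.z≤n ∅)
  where
  ring₁ : ∀ m → suc (suc m ℕ.+ m ℕ.+ 0) ≡ suc m ℕ.+ suc m
  ring₁ = ℕ-solve-∀
  ring₂ : ∀ m p → 0ℤ + (1ℤ + m + p) - p ≡ 1ℤ + m
  ring₂ = solve-∀

parity : ∀ j → ∃ λ q → j ≡ q ℕ.+ q ⊎ j ≡ suc (q ℕ.+ q)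
parity zero = 0 , inj₁ refl
parity (suc j) with parity j
... | q , inj₁ refl = q , inj₂ refl
... | q , inj₂ refl = suc q , inj₁ (cong suc (sym (ℕₚ.+-suc q q)))

-- A self-conjugate hook has odd size, so one or two of them are wrapped around
-- the core depending on the parity of n.
shape : ∀ m n → 6 ℕ.* m ℕ.+ 8 ≤ n → ∃₂ λ w h → Shape w h n (+ m)
shape m n le with ℕₚ.m≤n⇒∃[o]m+o≡n le
... | j , refl with parity j
-- The least arms that the bounds allow are m + 1 and then m + 2, and 2m + (2m + 3) + (2m + 5) is
-- the bound 6m + 8. The outer hook takes up the excess 2q.
... | q , inj₁ refl = subst (λ n → ∃₂ λ w h → Shape w h n (+ m)) (ring m q) (_ , _ ,
  selfConjugateHook (2 ℕ.+ m ℕ.+ q) (ℕₚ.m≤m+n (2 ℕ.+ m) q) (ℕₚ.m≤m+n (2 ℕ.+ m) q)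
    (selfConjugateHook (suc m) ℕₚ.≤-refl (ℕₚ.n≤1+n m) (core m)))
  where
  ring : ∀ m q → suc ((2 ℕ.+ m ℕ.+ q) ℕ.+ (2 ℕ.+ m ℕ.+ q) ℕ.+ suc (suc m ℕ.+ suc m ℕ.+ (m ℕ.+ m)))
                 ≡ 6 ℕ.* m ℕ.+ 8 ℕ.+ (q ℕ.+ q)
  ring = ℕ-solve-∀
-- One hook with arm 2m + 4 + q has size 4m + 9 + 2q; with the core of size 2m, the excess over the
-- bound is 2q + 1.
... | q , inj₂ refl = subst (λ n → ∃₂ λ w h → Shape w h n (+ m)) (ring m q) (_ , _ ,
  selfConjugateHook (suc m ℕ.+ (3 ℕ.+ m ℕ.+ q)) (ℕₚ.m≤m+n (suc m) _)
    (ℕₚ.≤-trans (ℕₚ.n≤1+n m) (ℕₚ.m≤m+n (suc m) _)) (core m))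
  where
  ring : ∀ m q → suc ((suc m ℕ.+ (3 ℕ.+ m ℕ.+ q)) ℕ.+ (suc m ℕ.+ (3 ℕ.+ m ℕ.+ q)) ℕ.+ (m ℕ.+ m))
                 ≡ 6 ℕ.* m ℕ.+ 8 ℕ.+ suc (q ℕ.+ q)
  ring = ℕ-solve-∀

-- The adjacency operator as a sum over swaps

sumℤ : List ℤ → ℤ
sumℤ = foldr _+_ 0ℤ

sumℤ-++ : ∀ xs ys → sumℤ (xs ++ ys) ≡ sumℤ xs + sumℤ ys
sumℤ-++ []       ys = sym (ℤₚ.+-identityˡ _)
sumℤ-++ (x ∷ xs) ys = trans (cong (_+_ x) (sumℤ-++ xs ys)) (sym (ℤₚ.+-assoc x _ _))

_<ₚ? : ∀ {n} (p : Fin n × Fin n) → Dec (toℕ (proj₁ p) ℕ.< toℕ (proj₂ p))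
p <ₚ? = toℕ (proj₁ p) ℕ.<? toℕ (proj₂ p)

sucₚ : ∀ {n} → Fin n × Fin n → Fin (suc n) × Fin (suc n)
sucₚ (i , j) = suc i , suc j

filter-row-suc : ∀ {n} (i : Fin n) js →
  filter _<ₚ? (map (suc i ,_) (map suc js)) ≡ map sucₚ (filter _<ₚ? (map (i ,_) js))
filter-row-suc i []       = refl
filter-row-suc i (j ∷ js) with does (toℕ i ℕ.<? toℕ j)
... | true  = cong (_ ∷_) (filter-row-suc i js)
... | false = filter-row-suc i js

filter-row-zero : ∀ {n} (js : List (Fin n)) →
  filter _<ₚ? (map (zero ,_) (map suc js)) ≡ map (λ j → zero , suc j) js
filter-row-zero []       = refl
filter-row-zero (j ∷ js) = cong (_ ∷_) (filter-row-zero js)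

filter-rows-suc : ∀ {n} (js is : List (Fin n)) →
  filter _<ₚ? (concatMap (λ i → map (i ,_) (zero ∷ map suc js)) (map suc is))
  ≡ map sucₚ (filter _<ₚ? (concatMap (λ i → map (i ,_) js) is))
filter-rows-suc js []       = refl
filter-rows-suc js (i ∷ is) = begin
  -- The pair `(suc i , zero)` at the head of the row fails the test by computation.
  filter _<ₚ? (map (suc i ,_) (map suc js) ++ rows⁺)
    ≡⟨ Listₚ.filter-++ _<ₚ? (map (suc i ,_) (map suc js)) rows⁺ ⟩
  filter _<ₚ? (map (suc i ,_) (map suc js)) ++ filter _<ₚ? rows⁺
    ≡⟨ cong₂ _++_ (filter-row-suc i js) (filter-rows-suc js is) ⟩
  map sucₚ (filter _<ₚ? (map (i ,_) js)) ++ map sucₚ (filter _<ₚ? rows)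
    ≡⟨ Listₚ.map-++ sucₚ (filter _<ₚ? (map (i ,_) js)) _ ⟨
  map sucₚ (filter _<ₚ? (map (i ,_) js) ++ filter _<ₚ? rows)
    ≡⟨ cong (map sucₚ) (Listₚ.filter-++ _<ₚ? (map (i ,_) js) rows) ⟨
  map sucₚ (filter _<ₚ? (map (i ,_) js ++ rows)) ∎
  where
  rows  = concatMap (λ i → map (i ,_) js) is
  rows⁺ = concatMap (λ i → map (i ,_) (zero ∷ map suc js)) (map suc is)

-- Splitting off the pairs with first entry `zero` reproduces the recursion of `Σswap`.
transpositions-suc : ∀ n →
  transpositions (suc n) ≡ map (λ j → zero , suc j) (allFin n) ++ map sucₚ (transpositions n)
transpositions-suc n = begin
  transpositions (suc n)
    ≡⟨ cong (λ js → filter _<ₚ? (concatMap (λ i → map (i ,_) (zero ∷ js)) (zero ∷ js)))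
         (sym (Listₚ.map-tabulate (λ i → i) suc)) ⟩
  filter _<ₚ? (map (zero ,_) (map suc (allFin n)) ++ rows⁺)
    ≡⟨ Listₚ.filter-++ _<ₚ? (map (zero ,_) (map suc (allFin n))) rows⁺ ⟩
  filter _<ₚ? (map (zero ,_) (map suc (allFin n))) ++ filter _<ₚ? rows⁺
    ≡⟨ cong₂ _++_ (filter-row-zero (allFin n)) (filter-rows-suc (allFin n) (allFin n)) ⟩
  map (λ j → zero , suc j) (allFin n) ++ map sucₚ (transpositions n) ∎
  where
  rows⁺ = concatMap (λ i → map (i ,_) (zero ∷ map suc (allFin n))) (map suc (allFin n))

-- Passes from decompositions of a list to indices.
Σpos-tabulate : ∀ {n} (g : A → List A → ℤ) y (p : Fin n → A) →
  Σpos (λ l a r → g a (l ++ y ∷ r)) (tabulate p)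
  ≡ sumℤ (tabulate λ j → g (p j) (tabulate (updateAt p j (λ _ → y))))
Σpos-tabulate {n = zero}  g y p = refl
Σpos-tabulate {n = suc n} g y p = cong (_+_ (g (p zero) (y ∷ tabulate (λ k → p (suc k)))))
  (Σpos-tabulate (λ a l → g a (p zero ∷ l)) y (λ k → p (suc k)))

transpose-zero-suc : ∀ {n} (p : Fin (suc n) → A) j k →
  p (transpose zero (suc j) (suc k)) ≡ updateAt (λ i → p (suc i)) j (λ _ → p zero) k
transpose-zero-suc p j k with k ≟ j
... | yes refl = sym (updateAt-updates j _)
... | no k≢j   = sym (updateAt-minimal k j _ k≢j)

transpose-suc-suc : ∀ {n} (i j k : Fin n) → transpose (suc i) (suc j) (suc k) ≡ suc (transpose i j k)
transpose-suc-suc i j k with does (k ≟ i)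
... | true  = refl
... | false with does (k ≟ j)
...   | true  = refl
...   | false = refl

-- Right multiplication by a transposition exchanges two positions in the list of values. In the
-- induction the fixed head is absorbed into `g`.
Σtranspositions : ∀ n (p : Fin n → A) g →
  sumℤ (map (λ τ → g (tabulate (λ k → p (transpose (proj₁ τ) (proj₂ τ) k)))) (transpositions n))
  ≡ Σswap g (tabulate p)
Σtranspositions zero    p g = refl
Σtranspositions (suc n) p g = begin
  sumℤ (map f (transpositions (suc n)))
    ≡⟨ cong (λ ts → sumℤ (map f ts)) (transpositions-suc n) ⟩
  sumℤ (map f (map (λ j → zero , suc j) (allFin n) ++ map sucₚ (transpositions n)))
    ≡⟨ cong sumℤ (Listₚ.map-++ f (map (λ j → zero , suc j) (allFin n)) _) ⟩
  sumℤ (map f (map (λ j → zero , suc j) (allFin n)) ++ map f (map sucₚ (transpositions n)))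
    ≡⟨ sumℤ-++ (map f (map (λ j → zero , suc j) (allFin n))) _ ⟩
  sumℤ (map f (map (λ j → zero , suc j) (allFin n))) + sumℤ (map f (map sucₚ (transpositions n)))
    ≡⟨ cong₂ (λ xs ys → sumℤ xs + sumℤ ys) firstRow otherRows ⟩
  sumℤ (tabulate λ j → g (p (suc j) ∷ tabulate (updateAt p′ j (λ _ → p zero))))
    + sumℤ (map (λ τ → g (p zero ∷ tabulate (λ k → p′ (transpose (proj₁ τ) (proj₂ τ) k)))) (transpositions n))
    ≡⟨ cong₂ _+_ (sym (Σpos-tabulate (λ a l → g (a ∷ l)) (p zero) p′))
         (Σtranspositions n p′ (λ l → g (p zero ∷ l))) ⟩
  Σswap g (tabulate p) ∎
  where
  p′ : Fin n → _
  p′ k = p (suc k)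
  f : Fin (suc n) × Fin (suc n) → ℤ
  f τ = g (tabulate (λ k → p (transpose (proj₁ τ) (proj₂ τ) k)))
  firstRow : map f (map (λ j → zero , suc j) (allFin n))
             ≡ tabulate λ j → g (p (suc j) ∷ tabulate (updateAt p′ j (λ _ → p zero)))
  firstRow = trans (sym (Listₚ.map-∘ (allFin n))) (trans (Listₚ.map-tabulate (λ j → j) _)
    (Listₚ.tabulate-cong λ j → cong (λ l → g (p (suc j) ∷ l)) (Listₚ.tabulate-cong (transpose-zero-suc p j))))
  otherRows : map f (map sucₚ (transpositions n))
              ≡ map (λ τ → g (p zero ∷ tabulate (λ k → p′ (transpose (proj₁ τ) (proj₂ τ) k)))) (transpositions n)
  otherRows = trans (sym (Listₚ.map-∘ (transpositions n))) (Listₚ.map-cong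
    (λ τ → cong (λ l → g (p zero ∷ l)) (Listₚ.tabulate-cong λ k → cong p (transpose-suc-suc (proj₁ τ) (proj₂ τ) k)))
    (transpositions n))

-- Integers as rationals

/1≡fromℤ : ∀ i → i / 1 ≡ fromℤ i
/1≡fromℤ i = ℚₚ.↥p/↧p≡p (fromℤ i)

/1-injective : ∀ {i j} → i / 1 ≡ j / 1 → i ≡ j
/1-injective {i} {j} eq = cong ℚ.↥_ (trans (sym (/1≡fromℤ i)) (trans eq (/1≡fromℤ j)))

-- `_/ 1` normalises its fraction, whereas `fromℤ` has denominator 1 by definition, so rational
-- addition computes on it.
/1-+ : ∀ i j → (i + j) / 1 ≡ i / 1 ℚ.+ j / 1
/1-+ i j = trans (cong (_/ 1) (sym (cong₂ _+_ (ℤₚ.*-identityʳ i) (ℤₚ.*-identityʳ j))))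
  (sym (cong₂ ℚ._+_ (/1≡fromℤ i) (/1≡fromℤ j)))

/1-* : ∀ i j → (i * j) / 1 ≡ (i / 1) ℚ.* (j / 1)
/1-* i j = sym (cong₂ ℚ._*_ (/1≡fromℤ i) (/1≡fromℤ j))

sumℚ-/1 : ∀ (f : A → ℤ) ts → sumℚ (map (λ τ → f τ / 1) ts) ≡ sumℤ (map f ts) / 1
sumℚ-/1 f []       = refl
sumℚ-/1 f (τ ∷ ts) = trans (cong (ℚ._+_ (f τ / 1)) (sumℚ-/1 f ts)) (sym (/1-+ (f τ) _))

-- Eigenvalues from partitions

values : ∀ {n} → Vec (Fin n) n → List ℤ
values π = tabulate λ k → + toℕ (Vec.lookup π k)

shape⇒eigenvalue : ∀ {w h n e} → Shape w h n e → IsEigenvalueT n (e / 1)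
shape⇒eigenvalue {n = n} {e = e} S =
  v , (Vec.allFin n , allFin-perm , nonzero) , λ π _ → eigen π
  where
  open Shape S
  v : Vec (Fin n) n → ℚ.ℚ
  v π = specht columns (values π) / 1
  allFin-perm : IsPerm (Vec.allFin n)
  allFin-perm a b eq = trans (sym (Vecₚ.lookup-allFin a)) (trans eq (Vecₚ.lookup-allFin b))
  nonzero : v (Vec.allFin n) ≢ ℚ.0ℚ
  -- The entries of the identity permutation are pairwise distinct.
  nonzero eq = specht-≢0 columns
    (Unique.tabulate⁺ λ {a} {b} e → allFin-perm a b (Finₚ.toℕ-injective (ℤₚ.+-injective e)))
    (/1-injective eq)
  eigen : ∀ π → adj v π ≡ e / 1 ℚ.* v π
  eigen π = begin
    sumℚ (map (λ τ → v (π ∘ᵗ τ)) (transpositions n))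
      ≡⟨ cong sumℚ (Listₚ.map-cong (λ τ → cong (λ xs → specht columns xs / 1)
           (Listₚ.tabulate-cong λ k → cong (λ i → + toℕ i) (Vecₚ.lookup∘tabulate _ k))) (transpositions n)) ⟩
    sumℚ (map (λ τ → specht columns (tabulate λ k → + toℕ (Vec.lookup π (transpose (proj₁ τ) (proj₂ τ) k))) / 1)
               (transpositions n))
      ≡⟨ sumℚ-/1 _ (transpositions n) ⟩
    sumℤ (map (λ τ → specht columns (tabulate λ k → + toℕ (Vec.lookup π (transpose (proj₁ τ) (proj₂ τ) k))))
               (transpositions n)) / 1
      ≡⟨ cong (_/ 1) (Σtranspositions n (λ k → + toℕ (Vec.lookup π k)) (specht columns)) ⟩
    Σswap (specht columns) (values π) / 1
      ≡⟨ cong (_/ 1) (Σswap-specht columns descending (values π) (trans (Listₚ.length-tabulate _) (sym size))) ⟩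
    (content columns * specht columns (values π)) / 1
      ≡⟨ cong (λ z → (z * specht columns (values π)) / 1) contents ⟩
    (e * specht columns (values π)) / 1
      ≡⟨ /1-* e _ ⟩
    e / 1 ℚ.* v π ∎

theorem2 : ∀ (k : ℕ) → ∃ λ (n₀ : ℕ) → ∀ (n : ℕ) → n₀ ≤ n → ∀ (m : ℕ) → m ≤ k → IsEigenvalueT n ((+ m) / 1)
-- The bound of `shape` increases with `m`, so its value at `k` serves every `m` up to `k`.
theorem2 k = 6 ℕ.* k ℕ.+ 8 , λ n n₀≤n m m≤k →
  let _ , _ , S = shape m n (ℕₚ.≤-trans (ℕₚ.+-monoˡ-≤ 8 (ℕₚ.*-monoʳ-≤ 6 m≤k)) n₀≤n)
  in shape⇒eigenvalue S
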